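{- Assume the limited principle of omniscience $\mathsf{LPO}$, and assume that for all sets $A$ and $B$ which both have the strong Myhill property, $A + B$ has the Myhill property or $A \times B$ has the Myhill property. Then excluded middle holds (i.e. $p \vee \neg p$ for every $p \in \Omega$).
   Context: The statement is to be proved constructively (intuitionistic set theory with powersets and $\mathbb{N}$, equivalently the internal logic of a topos with natural numbers object; neither excluded middle nor choice is assumed). $\Omega = \mathcal{P}(1)$ is the set of truth values; $+$ is disjoint union. $\mathsf{LPO}$: for every $p \in 2^{\mathbb{N}}$, either $p$ is the constant $0$ sequence or there exists $n$ with $p_n = 1$. A set $X$ has the Myhill property if for all subsets $A, B \subseteq X$: if there are injections $f, g : X \to X$ with $A = f^{ -1}(B)$ and $B = g^{ -1}(A)$, then there is a bijection $h : X \to X$ which restricts to a bijection between $A$ and $B$. For injections $f, g : X \to X$ and $m \in \mathbb{Z}$, let $R^{f,g}_m \subseteq X \times X$ be the partial injection $f \circ (g \circ f)^m$: for $m \ge 0$, $(x,y) \in R^{f,g}_m$ iff $y = f((g\circ f)^m(x))$; for $m < 0$, $(x,y) \in R^{f,g}_m$ iff $x = g((f \circ g)^{ -m-1}(y))$. A set $X$ has the strong Myhill property if for every pair of injections $f, g : X \to X$ there is a bijection $h : X \to X$ whose graph is contained in $\bigcup_{m \in \mathbb{Z}} R^{f,g}_m$. -}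

module Defs where

open import Data.Bool.Base using (Bool; true; false)
open import Data.Integer.Base using (ℤ; +_; -[1+_])
open import Data.Nat.Base using (ℕ)
open import Data.Product.Base using (Σ; Σ-syntax; ∃; _×_; _,_)
open import Data.Sum.Base using (_⊎_)
open import Function.Base using (_∘_)
open import Function.Bundles using (_↣_; _⤖_; Injection; Bijection)
open import Function.Definitions using (Bijective)
open import Level using (Level; suc; _⊔_)
open import Relation.Binary.Core using (Rel)
open import Relation.Binary.PropositionalEquality.Core using (_≡_)
open import Relation.Nullary using (Irrelevant)
open import Relation.Unary using (Pred; _∈_; _⊢_; _≐_)
import Function.Endo.Propositional as Endo
import Relation.Unary as Unary

open Injection using () renaming (to to ⟨_⟩)
open Bijection using () renaming (to to ⟪_⟫)

-- Sets are the types in Set ℓ (all of them satisfy UIP by axiom K), truth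
-- values are the types in Set ℓ with at most one element, and subsets are the
-- predicates valued in such types.
module Sets (ℓ : Level) where

  private
    variable
      a b : Level
      X : Set ℓ

  -- Mere inhabitation, by the second-order encoding over truth values.
  -- Disjunction and existence have to be truncated: read as plain ⊎ and Σ
  -- they would provide a choice of disjunct or witness.
  ∥_∥ : Set a → Set (a ⊔ suc ℓ)
  ∥ P ∥ = (q : Set ℓ) → Irrelevant q → (P → q) → q

  infixr 1 _∨_

  _∨_ : Set a → Set b → Set (a ⊔ b ⊔ suc ℓ)
  P ∨ Q = ∥ P ⊎ Q ∥

  Exists : {I : Set a} → (I → Set b) → Set (a ⊔ b ⊔ suc ℓ)
  Exists P = ∥ ∃ P ∥

  LPO : Set (suc ℓ)
  LPO = (p : ℕ → Bool) → (∀ n → p n ≡ false) ∨ Exists (λ n → p n ≡ true)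

  RestrictsToBijection : (X → X) → Pred X ℓ → Pred X ℓ → Set ℓ
  RestrictsToBijection {X} h A B =
    Σ[ maps ∈ (∀ x → x ∈ A → h x ∈ B) ]
      Bijective {A = Σ X A} {B = Σ X B} _≡_ _≡_ λ (x , x∈A) → h x , maps x x∈A

  Myhill : Set ℓ → Set (suc ℓ)
  Myhill X =
    (A B : Pred X ℓ) → Unary.Irrelevant A → Unary.Irrelevant B →
    (f g : X ↣ X) → A ≐ (⟨ f ⟩ ⊢ B) → B ≐ (⟨ g ⟩ ⊢ A) →
    Exists λ (h : X ⤖ X) → RestrictsToBijection ⟪ h ⟫ A B

  -- R f g m is the partial injection f ∘ (g ∘ f)ᵐ; as -[1+ n ] is -(n+1), the
  -- exponent -m-1 of the negative case is n.
  R : (f g : X → X) → ℤ → Rel X ℓ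
  R {X} f g (+ n)    x y = y ≡ f (((g ∘ f) ^ n) x) where open Endo X using (_^_)
  R {X} f g -[1+ n ] x y = x ≡ g (((f ∘ g) ^ n) y) where open Endo X using (_^_)

  StrongMyhill : Set ℓ → Set (suc ℓ)
  StrongMyhill X =
    (f g : X ↣ X) →
    Exists λ (h : X ⤖ X) →
      ∀ x y → y ≡ ⟪ h ⟫ x → Exists λ (m : ℤ) → R ⟨ f ⟩ ⟨ g ⟩ m x y

module Submission where

-- Given LPO, ℕ has the strong Myhill property by the Cantor–Bernstein argument,
-- and so does 1 + p because its injections are surjective.  Both ℕ + (1 + p) and
-- ℕ × (1 + p) have the form ℕ + p + rest.  There, shifting ℕ by two makes room
-- for p at 0 or at 1, so "the even numbers and p" and "the even numbers" reduce
-- to each other.  A bijection h carrying the first subset to the second sends p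
-- to a number; hence p holds iff h⁻¹ n lies in p for some n, which LPO decides.

open import Defs
open import Data.Bool.Base using (Bool; true; false; T)
open import Data.Bool.Properties using (T-irrelevant)
open import Data.Empty using (⊥-elim; ⊥-elim-irr)
open import Data.Integer.Base using (+_; -[1+_])
open import Data.Irrelevant using ([_])
open import Data.Nat.Base using (ℕ; zero; suc; _≤_; z≤n; s≤s)
open import Data.Nat.Properties using (≤-antisym; _≟_)
open import Data.Product.Base using (∃; _×_; _,_; proj₁; proj₂)
open import Data.Refinement.Base using (Refinement-syntax; _,_)
open import Data.Sum.Algebra using (⊎-cong; ⊎-comm)
open import Data.Sum.Base using (_⊎_; inj₁; inj₂; [_,_]′)
open import Data.Unit.Polymorphic.Base using (⊤; tt)
open import Function.Base using (_∘_)
open import Function.Bundles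
  using (_↣_; _↔_; Injection; Inverse; mk↣; mk⤖; mk↔ₛ′)
open import Function.Construct.Composition using (_↣-∘_)
open import Function.Construct.Identity using (↔-id)
open import Function.Construct.Symmetry using (↔-sym)
open import Function.Definitions using (Injective)
open import Function.Properties.Bijection using (⤖⇒↔)
open import Function.Properties.Inverse using (↔⇒↣)
open import Level using (Level; Lift; lift; lower)
open import Relation.Binary.Definitions using (DecidableEquality)
open import Relation.Binary.PropositionalEquality
  using (_≡_; refl; sym; trans; cong; subst)
open import Relation.Nullary using (¬_; Dec; yes; no; Irrelevant; does; contradiction)
open import Relation.Nullary.Decidable
  using (map′; recompute; dec-true; toSum; _×-dec_; ¬?)
open import Relation.Unary using (Pred; Decidable; _≐_; _⊢_)
import Function.Endo.Propositional as Endo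

open Injection using () renaming (to to ⟨_⟩; injective to ⟨⟩-injective)

private
  variable
    a b : Level

-- Least witnesses of Boolean sequences.

IsLeast : (ℕ → Bool) → ℕ → Set
IsLeast p n = p n ≡ true × (∀ m → p m ≡ true → n ≤ m)

-- The specifications are irrelevant components: without function extensionality
-- they are not provably propositions.
Least Never : (ℕ → Bool) → Set
Least p = [ n ∈ ℕ ∣ IsLeast p n ]
Never p = [ _ ∈ ⊤ ∣ (∀ n → p n ≡ false) ]

true≢false : {b : Bool} → b ≡ true → ¬ (b ≡ false)
true≢false refl ()

least : (p : ℕ → Bool) (n : ℕ) → p n ≡ true → ∃ (IsLeast p)
least p zero    pn = zero , pn , λ _ _ → z≤n
least p (suc n) pn with p zero in p0
... | true  = zero , p0 , λ _ _ → z≤n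
... | false with least (p ∘ suc) n pn
...   | k , pk , k≤ = suc k , pk , λ where
        zero    pm → ⊥-elim (true≢false pm p0)
        (suc m) pm → s≤s (k≤ m pm)

Least-irrelevant : (p : ℕ → Bool) → Irrelevant (Least p)
Least-irrelevant p (m , [ pm ]) (n , [ pn ])
  -- The minimality proofs are irrelevant, so they give `m ≡ n` only irrelevantly; decidable
  -- equality recovers it.
  with refl ← recompute (m ≟ n)
         (≤-antisym (proj₂ pm n (proj₁ pn)) (proj₂ pn m (proj₁ pm))) = refl

Least⊎Never-irrelevant : (p : ℕ → Bool) → Irrelevant (Least p ⊎ Never p)
Least⊎Never-irrelevant p (inj₁ l) (inj₁ l′) = cong inj₁ (Least-irrelevant p l l′)
Least⊎Never-irrelevant p (inj₂ _) (inj₂ _)  = refl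
Least⊎Never-irrelevant p (inj₁ (n , [ l ])) (inj₂ (_ , [ v ])) =
  ⊥-elim-irr (true≢false (proj₁ l) (v n))
Least⊎Never-irrelevant p (inj₂ (_ , [ v ])) (inj₁ (n , [ l ])) =
  ⊥-elim-irr (true≢false (proj₁ l) (v n))

does⇒ : {P : Set a} (P? : Dec P) → does P? ≡ true → P
does⇒ (yes p) _ = p

-- Truncation, search and the strong Myhill property.

module _ {ℓ : Level} where

  open Sets ℓ

  N : Set ℓ
  N = Lift ℓ ℕ

  return : {P : Set a} → P → ∥ P ∥
  return x _ _ k = k x

  infixl 1 _>>=_
  _>>=_ : {P : Set a} {Q : Set b} → ∥ P ∥ → (P → ∥ Q ∥) → ∥ Q ∥
  (m >>= f) q irr k = m q irr λ x → f x q irr k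

  Searchable : Set a → Set _
  Searchable X = {P : Pred X ℓ} → Decidable P → Dec (∃ P)

  -- The truncation in LPO is removed by searching for the least witness, which
  -- is unique.
  LPO⇒searchable : LPO → Searchable ℕ
  LPO⇒searchable lpo {P} P? =
    decide (lower (lpo p (Lift ℓ (Least p ⊎ Never p)) irr found))
    where
    p : ℕ → Bool
    p n = does (P? n)

    irr : Irrelevant (Lift ℓ (Least p ⊎ Never p))
    irr (lift x) (lift y) = cong lift (Least⊎Never-irrelevant p x y)

    witness : ∃ (λ n → p n ≡ true) → Lift ℓ (Least p ⊎ Never p)
    witness (n , pn) with k , l ← least p n pn = lift (inj₁ (k , [ l ]))

    found : (∀ n → p n ≡ false) ⊎ Exists (λ n → p n ≡ true) →
            Lift ℓ (Least p ⊎ Never p)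
    found (inj₁ never) = lift (inj₂ (tt , [ never ]))
    found (inj₂ some)  = some _ irr witness

    decide : Least p ⊎ Never p → Dec (∃ P)
    decide (inj₁ (n , [ l ])) = yes (n , recompute (P? n) (does⇒ (P? n) (proj₁ l)))
    decide (inj₂ (_ , [ v ])) = no λ (n , x) →
      ⊥-elim-irr (true≢false (dec-true (P? n) x) (v n))

  -- The Cantor–Bernstein argument: h follows g⁻¹ on the points whose backward
  -- chain stops outside the image of f, and f elsewhere, so only the exponents
  -- -1 and 0 occur.
  searchable⇒StrongMyhill : {X : Set ℓ} → Searchable ℕ → Searchable X →
                            DecidableEquality X → StrongMyhill X
  searchable⇒StrongMyhill {X} searchℕ searchX _≟ₓ_ 𝑓 𝑔 =
    return (mk⤖ (h-injective , h-surjective) , λ x y y≡ → return (h-graph x y y≡))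
    where
    open Endo X using (_^_)

    f g : X → X
    f = ⟨ 𝑓 ⟩
    g = ⟨ 𝑔 ⟩

    chain : ℕ → X → X
    chain k = (f ∘ g) ^ k

    Stops : X → Set ℓ
    Stops x = ∃ λ k → ∃ λ y → x ≡ g (chain k y) × ¬ ∃ λ z → f z ≡ y

    image? : Decidable λ y → ∃ λ z → f z ≡ y
    image? y = searchX λ z → f z ≟ₓ y

    stops? : Decidable Stops
    stops? x = searchℕ λ k → searchX λ y → (x ≟ₓ g (chain k y)) ×-dec ¬? (image? y)

    stops-extend : ∀ {x} → Stops x → Stops (g (f x))
    stops-extend (k , y , refl , y∉f) = suc k , y , refl , y∉f

    step : ∀ {x} → Dec (Stops x) → X
    -- The stopping data already contain the `g`-preimage of `x`.
    step     (yes (k , y , _)) = chain k y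
    step {x} (no _)            = f x

    h : X → X
    h x = step (stops? x)

    g-step : ∀ {x} (s : Stops x) → g (step (yes s)) ≡ x
    g-step (_ , _ , x≡ , _) = sym x≡

    -- An equality would put `y` in the image of `f` if `k` is 0; otherwise, cancelling one `f`
    -- makes the chain of `x′` stop at `y` too.
    step≢f : ∀ {x x′} (s : Stops x) → ¬ Stops x′ → ¬ (step (yes s) ≡ f x′)
    step≢f (zero  , y , _ , y∉f) _   y≡  = y∉f (_ , sym y≡)
    step≢f (suc k , y , _ , y∉f) ¬s′ fg≡ =
      ¬s′ (k , y , sym (⟨⟩-injective 𝑓 fg≡) , y∉f)

    h-injective : Injective _≡_ _≡_ h
    h-injective {x} {x′} eq with stops? x | stops? x′
    ... | yes s | yes s′ = trans (sym (g-step s)) (trans (cong g eq) (g-step s′))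
    ... | yes s | no ¬s′ = ⊥-elim (step≢f s ¬s′ eq)
    ... | no ¬s | yes s′ = ⊥-elim (step≢f s′ ¬s (sym eq))
    ... | no _  | no _   = ⟨⟩-injective 𝑓 eq

    -- If the chain of `g y` stops, `h` sends `g y` to `y`. Otherwise `y` is some `f x`, as a `y`
    -- outside the image of `f` would stop that chain at once; and `x` does not stop, since a stop
    -- of `x` extends to `g (f x)`.
    preimage : ∀ y → ∃ λ x → h x ≡ y
    preimage y with stops? (g y) in eq
    ... | yes s = g y , trans (cong step eq) (⟨⟩-injective 𝑔 (g-step s))
    ... | no ¬s with image? y
    ...   | no y∉f = contradiction (zero , y , refl , y∉f) ¬s
    ...   | yes (x , refl) with stops? x in eq′
    ...     | yes s′ = ⊥-elim (¬s (stops-extend s′))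
    ...     | no _   = x , cong step eq′

    h-surjective : ∀ y → ∃ λ x → ∀ {z} → z ≡ x → h z ≡ y
    h-surjective y with x , hx≡y ← preimage y = x , λ { refl → hx≡y }

    h-graph : ∀ x y → y ≡ h x → ∃ λ m → R f g m x y
    h-graph x y y≡ with stops? x
    ... | yes s = -[1+ 0 ] , sym (trans (cong g y≡) (g-step s))
    ... | no _  = + 0 , y≡

  coHopfian⇒StrongMyhill : {X : Set ℓ} →
    ((f : X ↣ X) → ∀ y → ∃ λ x → ⟨ f ⟩ x ≡ y) → StrongMyhill X
  coHopfian⇒StrongMyhill surj f g =
    return ( mk⤖ (⟨⟩-injective f , λ y → proj₁ (surj f y) , λ { refl → proj₂ (surj f y) })
           , λ x y y≡ → return (+ 0 , y≡))

  N-StrongMyhill : LPO → StrongMyhill N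
  N-StrongMyhill lpo =
    searchable⇒StrongMyhill search
      (λ P? → map′ (λ (n , x) → lift n , x) (λ (n , x) → lower n , x) (search (P? ∘ lift)))
      (λ m n → map′ (cong lift) (cong lower) (lower m ≟ lower n))
    where
    search : Searchable ℕ
    search = LPO⇒searchable lpo

  -- There is no need to decide `p`: either `f (inj₁ tt)` is `y`, or one of the two supplies an
  -- element `q` of `p`. Then the set has just two points, and injectivity forces `f (inj₂ q)` to be
  -- `y`.
  ⊤⊎-StrongMyhill : {p : Set ℓ} → Irrelevant p → StrongMyhill (⊤ {ℓ} ⊎ p)
  ⊤⊎-StrongMyhill {p} p-irr = coHopfian⇒StrongMyhill surj
    where
    surj : (f : (⊤ ⊎ p) ↣ (⊤ ⊎ p)) → ∀ y → ∃ λ x → ⟨ f ⟩ x ≡ y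
    surj f y with ⟨ f ⟩ (inj₁ tt) in f⊤
    surj f (inj₁ _) | inj₁ _ = inj₁ tt , f⊤
    surj f (inj₁ _) | inj₂ q with ⟨ f ⟩ (inj₂ q) in fq
    ... | inj₁ _ = inj₂ q , fq
    ... | inj₂ r = contradiction
      (⟨⟩-injective f (trans f⊤ (trans (cong inj₂ (p-irr q r)) (sym fq)))) λ ()
    surj f (inj₂ q) | inj₂ r = inj₁ tt , trans f⊤ (cong inj₂ (p-irr r q))
    surj f (inj₂ q) | inj₁ _ with ⟨ f ⟩ (inj₂ q) in fq
    ... | inj₁ _ = contradiction (⟨⟩-injective f (trans f⊤ (sym fq))) λ ()
    ... | inj₂ r = inj₂ q , trans fq (cong inj₂ (p-irr r q))

  -- Excluded middle from the Myhill property.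

  module _ {p rest : Set ℓ} where

    -- `rest` will be `⊤` for the sum and `N × p` for the product.
    Hotel : Set ℓ
    Hotel = N ⊎ (p ⊎ rest)

    even : ℕ → Bool
    even zero          = true
    even (suc zero)    = false
    even (suc (suc n)) = even n

    room : Bool → ℕ
    room true  = 0
    room false = 1

    -- The shift by two keeps parity; the guest from `p` gets the even free room if `p` counts as
    -- marked, the odd one if not.
    absorb : Bool → Hotel → Hotel
    absorb b (inj₁ (lift n)) = inj₁ (lift (suc (suc n)))
    absorb b (inj₂ (inj₁ _)) = inj₁ (lift (room b))
    absorb b (inj₂ (inj₂ r)) = inj₂ (inj₂ r)

    absorb-injective : Irrelevant p → ∀ b → Injective _≡_ _≡_ (absorb b)
    absorb-injective _   _     {inj₁ _}        {inj₁ _}        refl = refl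
    absorb-injective irr _     {inj₂ (inj₁ q)} {inj₂ (inj₁ r)} _    =
      cong (inj₂ ∘ inj₁) (irr q r)
    absorb-injective _   _     {inj₂ (inj₂ _)} {inj₂ (inj₂ _)} refl = refl
    absorb-injective _   true  {inj₁ _}        {inj₂ (inj₁ _)} ()
    absorb-injective _   false {inj₁ _}        {inj₂ (inj₁ _)} ()
    absorb-injective _   true  {inj₂ (inj₁ _)} {inj₁ _}        ()
    absorb-injective _   false {inj₂ (inj₁ _)} {inj₁ _}        ()

    -- mark true and mark false are the two subsets; they differ only on p.
    mark : Bool → Hotel → Bool
    mark b (inj₁ (lift n)) = even n
    mark b (inj₂ (inj₁ _)) = b
    mark b (inj₂ (inj₂ _)) = false

    -- The bit `c` is arbitrary because `absorb` never lands in `p`, the only place where it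
    -- matters.
    mark-absorb : ∀ b c y → mark c (absorb b y) ≡ mark b y
    mark-absorb _     _ (inj₁ _)        = refl
    mark-absorb true  _ (inj₂ (inj₁ _)) = refl
    mark-absorb false _ (inj₂ (inj₁ _)) = refl
    mark-absorb _     _ (inj₂ (inj₂ _)) = refl

    mark-false : ∀ y → T (mark false y) → ∃ λ n → y ≡ inj₁ (lift n)
    mark-false (inj₁ (lift n)) _ = n , refl
    mark-false (inj₂ (inj₁ _)) ()
    mark-false (inj₂ (inj₂ _)) ()

    guest? : (y : Hotel) → Dec (∃ λ q → y ≡ inj₂ (inj₁ q))
    guest? (inj₁ _)        = no λ ()
    guest? (inj₂ (inj₁ q)) = yes (q , refl)
    guest? (inj₂ (inj₂ _)) = no λ ()

    Myhill⇒excludedMiddle : {X : Set ℓ} → LPO → X ↔ Hotel → Irrelevant p →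
                            Myhill X → p ∨ (¬ p)
    Myhill⇒excludedMiddle {X} lpo φ p-irr myhill =
      myhill (Marked true) (Marked false)
        (Marked-irrelevant true) (Marked-irrelevant false)
        (shift true) (shift false) (Marked-shift true false) (Marked-shift false true)
      >>= λ (h , maps , _) → return (decide (⤖⇒↔ h) maps)
      where
      open Inverse φ using (to; from; strictlyInverseˡ; strictlyInverseʳ)

      Marked : Bool → Pred X ℓ
      Marked b x = Lift ℓ (T (mark b (to x)))

      Marked-irrelevant : ∀ b {x} → Irrelevant (Marked b x)
      Marked-irrelevant b (lift s) (lift t) = cong lift (T-irrelevant s t)

      shift : Bool → X ↣ X
      shift b = ↔⇒↣ (↔-sym φ) ↣-∘ (mk↣ (absorb-injective p-irr b) ↣-∘ ↔⇒↣ φ)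

      mark-shift : ∀ b c x → mark c (to (⟨ shift b ⟩ x)) ≡ mark b (to x)
      mark-shift b c x =
        trans (cong (mark c) (strictlyInverseˡ _)) (mark-absorb b c (to x))

      Marked-shift : ∀ b c → Marked b ≐ (⟨ shift b ⟩ ⊢ Marked c)
      Marked-shift b c =
          (λ {x} (lift t) → lift (subst T (sym (mark-shift b c x)) t))
        , (λ {x} (lift t) → lift (subst T (mark-shift b c x) t))

      decide : (h : X ↔ X) → (∀ x → Marked true x → Marked false (Inverse.to h x)) →
               p ⊎ ¬ p
      decide h maps =
        [ (λ (_ , q , _) → inj₁ q) , (λ none → inj₂ (none ∘ found)) ]′ (toSum search)
        where
        module H = Inverse h

        origin : ℕ → Hotel
        origin n = to (H.from (from (inj₁ (lift n))))

        search : Dec (∃ λ n → ∃ λ q → origin n ≡ inj₂ (inj₁ q))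
        search = LPO⇒searchable lpo λ n → guest? (origin n)

        found : p → ∃ λ n → ∃ λ q → origin n ≡ inj₂ (inj₁ q)
        -- The guest is marked for `true`, so its image under `h` is marked for `false` and hence a
        -- number `n`; going back along `h` from `n` returns the guest.
        found q = n , q , trans (cong (to ∘ H.from) room≡)
                                (trans (cong to (H.strictlyInverseʳ guest)) to-guest)
          where
          guest    = from (inj₂ (inj₁ q))
          to-guest = strictlyInverseˡ (inj₂ (inj₁ q))
          marked   = maps guest (lift (subst (T ∘ mark true) (sym to-guest) _))
          roomOf   = mark-false (to (H.to guest)) (lower marked)
          n        = proj₁ roomOf
          room≡    = trans (cong from (sym (proj₂ roomOf))) (strictlyInverseʳ (H.to guest))

  -- The copy of `p` at index 0 becomes the guest; the later copies move down by one.
  N×-hotel : {p : Set ℓ} → (N × (⊤ {ℓ} ⊎ p)) ↔ (N ⊎ (p ⊎ (N × p)))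
  N×-hotel {p} = mk↔ₛ′ to from to∘from from∘to
    where
    to : N × (⊤ ⊎ p) → N ⊎ (p ⊎ (N × p))
    to (n            , inj₁ _) = inj₁ n
    to (lift zero    , inj₂ q) = inj₂ (inj₁ q)
    to (lift (suc n) , inj₂ q) = inj₂ (inj₂ (lift n , q))

    from : N ⊎ (p ⊎ (N × p)) → N × (⊤ ⊎ p)
    from (inj₁ n)                   = n , inj₁ tt
    from (inj₂ (inj₁ q))            = lift zero , inj₂ q
    from (inj₂ (inj₂ (lift n , q))) = lift (suc n) , inj₂ q

    to∘from : ∀ y → to (from y) ≡ y
    to∘from (inj₁ _)        = refl
    to∘from (inj₂ (inj₁ _)) = refl
    to∘from (inj₂ (inj₂ _)) = refl

    from∘to : ∀ x → from (to x) ≡ x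
    from∘to (_            , inj₁ _) = refl
    from∘to (lift zero    , inj₂ _) = refl
    from∘to (lift (suc _) , inj₂ _) = refl

corollary28 : (ℓ : Level) → let open Sets ℓ in
    LPO →
    ((A B : Set ℓ) → StrongMyhill A → StrongMyhill B →
    Myhill (A ⊎ B) ∨ Myhill (A × B)) →
    (p : Set ℓ) → Irrelevant p → p ∨ (¬ p)
corollary28 ℓ lpo sum-or-product p p-irr =
  sum-or-product N (⊤ ⊎ p) (N-StrongMyhill lpo) (⊤⊎-StrongMyhill p-irr) >>=
  [ Myhill⇒excludedMiddle lpo (⊎-cong (↔-id N) (⊎-comm ⊤ p)) p-irr
  , Myhill⇒excludedMiddle lpo N×-hotel p-irr
  ]′
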